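{- For every integer $t \ge 2$, if $G$ is a connected chordal graph with no induced subgraph isomorphic to $K_t \bowtie \overline{K_t}$, then $\mathsf{lpt}(G) \le t-1$.
   Context: All graphs are finite and simple. A graph is chordal if it has no induced cycle of length at least four. For $n\in\mathbb{N}$, $K_n \bowtie \overline{K_n}$ denotes the graph on vertices $v_1^1,\dots,v_n^1,v_1^2,\dots,v_n^2$ in which $\{v_1^1,\dots,v_n^1\}$ is a clique, $\{v_1^2,\dots,v_n^2\}$ is an independent set, and $v_i^1$ is adjacent to $v_j^2$ if and only if $i=j$ (a clique and an independent set of size $n$ joined by a perfect matching). A longest path of a connected graph $G$ is a path of maximum length in $G$; a longest path transversal is a set of vertices meeting every longest path; $\mathsf{lpt}(G)$ is the minimum cardinality of a longest path transversal of $G$. -}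

module Defs where

open import Data.Empty using (⊥)
open import Data.Fin.Base using (Fin; zero; suc; toℕ)
open import Data.Fin.Properties as Fin using (injective⇒≤)
open import Data.Fin.Subset using (Subset; ∣_∣) renaming (_∈_ to _∈ˢ_; ⊤ to fullSet)
open import Data.Fin.Subset.Properties using (_∈?_; anySubset?; ∈⊤)
open import Data.List.Base
  using (List; []; _∷_; length; lookup; allFin; cartesianProductWith)
open import Data.List.Membership.Propositional using (_∈_)
open import Data.List.Membership.Propositional.Properties
  using (∈-cartesianProductWith⁺; ∈-allFin; ∈-lookup)
open import Data.List.Relation.Unary.All as All using (All)
open import Data.List.Relation.Unary.AllPairs using (_∷_)
open import Data.List.Relation.Unary.Any as Any using (Any; here; there)
open import Data.List.Relation.Unary.Linked using (Linked; linked?)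
open import Data.List.Relation.Unary.Unique.Propositional using (Unique)
open import Data.List.Relation.Unary.Unique.DecPropositional using (unique?)
open import Data.Nat.Base using (ℕ; zero; suc; _≤_; _<_; z≤n; s≤s)
open import Data.Nat.Induction using (<-wellFounded)
open import Data.Nat.Properties as ℕ using (_≤?_; _<?_; ≮⇒≥)
open import Data.Product.Base using (∃; _×_; _,_; proj₁; proj₂)
open import Data.Sum.Base using (_⊎_; inj₁; inj₂; swap)
open import Function.Base using (_∘_; case_of_)
open import Function.Bundles using (_⇔_)
open import Function.Definitions using (Injective)
open import Induction.WellFounded using (Acc; acc)
open import Level using (0ℓ)
open import Relation.Binary.Construct.Closure.ReflexiveTransitive using (Star)
open import Relation.Binary.Core using (Rel)
open import Relation.Binary.Definitions using (Decidable; Symmetric)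
open import Relation.Binary.PropositionalEquality
  using (_≡_; _≢_; refl; sym; cong; ≢-sym)
open import Relation.Nullary using (¬_; Dec; yes; no; contradiction)
open import Relation.Nullary.Decidable using (map′; _×-dec_; _⊎-dec_; _→-dec_; ¬?)

-- A simple graph on the vertex type V.  Adjacency is decidable, as it is
-- classically for every graph.  A finite graph is a Graph (Fin n).

record Graph (V : Set) : Set₁ where
  field
    Adj         : Rel V 0ℓ
    _adj?_      : Decidable Adj
    symmetric   : Symmetric Adj
    irreflexive : ∀ {v} → ¬ Adj v v

open Graph using (Adj)

-- An isomorphism from H onto the subgraph of G induced by the image of
-- embed.

record InducedCopy {W V : Set} (H : Graph W) (G : Graph V) : Set where
  field
    embed     : W → V
    injective : Injective _≡_ _≡_ embed
    adj⇔      : ∀ x y → Adj H x y ⇔ Adj G (embed x) (embed y)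

Connected : ∀ {V} → Graph V → Set
Connected {V} G = V × (∀ u v → Star (Adj G) u v)

-- j is the successor of i in the cyclic order 0, 1, …, m - 1, 0.

Next : ∀ {m} → Fin m → Fin m → Set
Next {m} i j = suc (toℕ i) ≡ toℕ j ⊎ (suc (toℕ i) ≡ m × toℕ j ≡ 0)

next? : ∀ {m} → Decidable (Next {m})
next? {m} i j =
  (suc (toℕ i) ℕ.≟ toℕ j) ⊎-dec ((suc (toℕ i) ℕ.≟ m) ×-dec (toℕ j ℕ.≟ 0))

-- The cycle of length m for m ≥ 3.  The condition i ≢ j is then redundant;
-- it only excludes a loop when m ≡ 1.

cycle : ∀ m → Graph (Fin m)
cycle m = record
  { Adj         = λ i j → i ≢ j × (Next i j ⊎ Next j i)
  ; _adj?_      = λ i j → ¬? (i Fin.≟ j) ×-dec (next? i j ⊎-dec next? j i)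
  ; symmetric   = λ (i≢j , e) → ≢-sym i≢j , swap e
  ; irreflexive = λ (i≢i , _) → i≢i refl
  }

Chordal : ∀ {V} → Graph V → Set
Chordal G = ∀ m → 4 ≤ m → ¬ InducedCopy (cycle m) G

-- inj₁ i is the i-th clique vertex, inj₂ i its partner in the independent
-- set.

MatchedAdj : ∀ {t} → Rel (Fin t ⊎ Fin t) 0ℓ
MatchedAdj (inj₁ i) (inj₁ j) = i ≢ j
MatchedAdj (inj₁ i) (inj₂ j) = i ≡ j
MatchedAdj (inj₂ i) (inj₁ j) = i ≡ j
MatchedAdj (inj₂ i) (inj₂ j) = ⊥

K⋈K̄ : ∀ t → Graph (Fin t ⊎ Fin t)
K⋈K̄ t = record
  { Adj         = MatchedAdj
  ; _adj?_      = dec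
  ; symmetric   = λ {u} {v} → symm u v
  ; irreflexive = λ {v} → irr v
  }
  where
  dec : Decidable (MatchedAdj {t})
  dec (inj₁ i) (inj₁ j) = ¬? (i Fin.≟ j)
  dec (inj₁ i) (inj₂ j) = i Fin.≟ j
  dec (inj₂ i) (inj₁ j) = i Fin.≟ j
  dec (inj₂ i) (inj₂ j) = no λ ()

  symm : ∀ (u v : Fin t ⊎ Fin t) → MatchedAdj u v → MatchedAdj v u
  symm (inj₁ _) (inj₁ _) = ≢-sym
  symm (inj₁ _) (inj₂ _) = sym
  symm (inj₂ _) (inj₁ _) = sym

  irr : ∀ (v : Fin t ⊎ Fin t) → ¬ MatchedAdj v v
  irr (inj₁ _) i≢i = i≢i refl

-- A path is given by its sequence of vertices; it has at least one vertex.

record IsPath {V} (G : Graph V) (p : List V) : Set where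
  constructor mkIsPath
  field
    nonempty : p ≢ []
    linked   : Linked (Adj G) p
    unique   : Unique p

-- Comparing numbers of vertices is the same as comparing numbers of edges,
-- since a path with k edges has k + 1 vertices.

IsLongestPath : ∀ {V} → Graph V → List V → Set
IsLongestPath G p = IsPath G p × (∀ q → IsPath G q → length q ≤ length p)

module _ {n} (G : Graph (Fin n)) where

  IsTransversal : Subset n → Set
  IsTransversal S = ∀ p → IsLongestPath G p → Any (_∈ˢ S) p

  IsLpt : ℕ → Set
  IsLpt k = (∃ λ S → IsTransversal S × ∣ S ∣ ≡ k)
          × (∀ S → IsTransversal S → k ≤ ∣ S ∣)

-- The minimum in IsLpt exists: there are finitely many paths, so being a
-- transversal is decidable, and the set of all vertices is a transversal.

unique⇒lookup-injective : ∀ {A : Set} {xs : List A} → Unique xs →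
                          Injective _≡_ _≡_ (lookup xs)
unique⇒lookup-injective (_  ∷ _) {zero}  {zero}  _ = refl
unique⇒lookup-injective (px ∷ _) {zero}  {suc j} e =
  contradiction e (All.lookup px (∈-lookup j))
unique⇒lookup-injective (px ∷ _) {suc i} {zero}  e =
  contradiction (sym e) (All.lookup px (∈-lookup i))
unique⇒lookup-injective (_  ∷ u) {suc i} {suc j} e =
  cong suc (unique⇒lookup-injective u e)

unique⇒length≤ : ∀ {n} {xs : List (Fin n)} → Unique xs → length xs ≤ n
unique⇒length≤ = injective⇒≤ ∘ unique⇒lookup-injective

listsUpTo : ∀ n → ℕ → List (List (Fin n))
listsUpTo n zero    = [] ∷ []
listsUpTo n (suc k) = [] ∷ cartesianProductWith _∷_ (allFin n) (listsUpTo n k)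

∈-listsUpTo : ∀ {n k} (xs : List (Fin n)) → length xs ≤ k → xs ∈ listsUpTo n k
∈-listsUpTo {k = zero}  []       _       = here refl
∈-listsUpTo {k = suc k} []       _       = here refl
∈-listsUpTo {k = suc k} (x ∷ xs) (s≤s l) =
  there (∈-cartesianProductWith⁺ _∷_ (∈-allFin x) (∈-listsUpTo xs l))

module _ {n} (G : Graph (Fin n)) where

  isPath? : ∀ p → Dec (IsPath G p)
  isPath? p = map′ (λ (a , b , c) → mkIsPath a b c)
                   (λ (mkIsPath a b c) → a , b , c)
                   (nonempty? p ×-dec linked? (Graph._adj?_ G) p
                                ×-dec unique? Fin._≟_ p)
    where
    nonempty? : ∀ (p : List (Fin n)) → Dec (p ≢ [])
    nonempty? []      = no λ ne → ne refl
    nonempty? (_ ∷ _) = yes λ ()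

  allPaths? : ∀ {P : List (Fin n) → Set} → (∀ p → Dec (P p)) →
              Dec (∀ p → IsPath G p → P p)
  allPaths? P? = map′
    (λ ps p π → All.lookup ps (∈-listsUpTo p (unique⇒length≤ (IsPath.unique π))) π)
    (λ f → All.universal f _)
    (All.all? (λ p → isPath? p →-dec P? p) (listsUpTo n n))

  isTransversal? : ∀ S → Dec (IsTransversal G S)
  isTransversal? S = map′
    (λ f p (π , longest) → f p π longest)
    (λ f p π longest → f p (π , longest))
    (allPaths? λ p → allPaths? (λ q → length q ≤? length p)
                     →-dec Any.any? (_∈? S) p)

  fullSet-isTransversal : IsTransversal G fullSet
  fullSet-isTransversal []      (π , _) = contradiction refl (IsPath.nonempty π)
  fullSet-isTransversal (_ ∷ _) _       = here ∈⊤

  isLpt-exists : ∃ (IsLpt G)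
  isLpt-exists = search fullSet fullSet-isTransversal (<-wellFounded _)
    where
    search : ∀ S → IsTransversal G S → Acc _<_ ∣ S ∣ → ∃ (IsLpt G)
    search S tr (acc rs) =
      case anySubset? (λ T → isTransversal? T ×-dec (∣ T ∣ <? ∣ S ∣)) of λ where
        (yes (T , trT , T<S)) → search T trT (rs T<S)
        (no  none)            → ∣ S ∣ , (S , tr , refl) ,
                                λ T trT → ≮⇒≥ λ T<S → none (T , trT , T<S)

  lpt : ℕ
  lpt = proj₁ isLpt-exists

  lpt-isLpt : IsLpt G lpt
  lpt-isLpt = proj₂ isLpt-exists

{-# OPTIONS --safe #-}
-- A connected chordal graph has a clique meeting all longest paths.  Keep a
-- connected vertex set C that contains a longest path and whose boundary ∂C is a
-- clique.  By chordality some v ∈ C is complete to ∂C.  If the clique {v} ∪ ∂C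
-- misses a longest path, then, since any two longest paths meet, that path lies in
-- a component of C − v, and this component replaces C.
--
-- Now let K be a clique transversal that is minimal under deleting vertices.  Each
-- v ∈ K has a longest path with v as its only vertex in K.  The successor x of v on
-- it is adjacent to no other u ∈ K, as otherwise u could be inserted between v and
-- x.  These successors are pairwise nonadjacent by chordality, so K together with
-- them induces a clique matched to an independent set, whence |K| < t.

module Submission where

open import Defs
open import Algebra.Properties.CommutativeSemigroup using (interchange)
open import Data.Fin.Base using (Fin; zero; suc; toℕ; inject≤)
open import Data.Fin.Properties as Fin
  using (any?; sequence; inject≤-injective; suc-injective; all?)
open import Data.Fin.Subset
  using (Subset; ∣_∣; inside; outside; _-_; ⁅_⁆)
  renaming (_∈_ to _∈ˢ_; _∉_ to _∉ˢ_; ⊤ to fullSet; ⊥ to ∅)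
open import Data.Fin.Subset.Properties
  using (_∈?_; ∈⊤; ∉⊥; p⊂q⇒∣p∣<∣q∣; p⊆q⇒∣p∣≤∣q∣; x∈p∧x≢y⇒x∈p-y; x∈p⇒∣p-x∣<∣p∣;
         p─q⊆p; ∣⁅x⁆∣≡1; x∈⁅x⁆; anySubset?)
open import Data.List.Base
  using (List; []; _∷_; _++_; _ʳ++_; length; reverse; lookup; allFin)
open import Data.List.Membership.DecPropositional
  using () renaming (_∈?_ to member?)
open import Data.List.Membership.Propositional using (_∈_; _∉_; lose; find)
open import Data.List.Membership.Propositional.Properties
  using (∈-∃++; ∈-++⁺ʳ; ∈-lookup; ∈-insert; ∈-allFin)
open import Data.List.Properties
  using (length-++; length-ʳ++; length-reverse; reverse-++; unfold-reverse;
         ++-assoc)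
open import Data.List.Relation.Binary.Permutation.Propositional
  using (_↭_; ↭-sym; ↭⇒↭ₛ)
open import Data.List.Relation.Binary.Permutation.Propositional.Properties
  using (∈-resp-↭; ++↭ʳ++; ↭-reverse; shift; ↭-length)
open import Data.List.Relation.Binary.Permutation.Setoid.Properties
  using (Unique-resp-↭)
open import Data.List.Relation.Unary.All as All using (All; []; _∷_)
open import Data.List.Relation.Unary.All.Properties using (¬Any⇒All¬)
open import Data.List.Relation.Unary.AllPairs as AllPairs using ([]; _∷_)
open import Data.List.Relation.Unary.Any as Any using (here; there; Any)
open import Data.List.Relation.Unary.Linked as Linked
  using (Linked; []; [-]; _∷_)
open import Data.List.Relation.Unary.Unique.Propositional using (Unique)
open import Data.List.Relation.Unary.Unique.Propositional.Properties using (++⁺)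
open import Data.Nat.Base using (ℕ; zero; suc; _+_; _≤_; _<_; s≤s; z≤n; _∸_)
open import Data.Nat.Induction using (<-wellFounded)
open import Data.Nat.Properties as ℕ using ()
open import Data.Product.Base using (∃; _×_; _,_; proj₁; proj₂)
open import Data.Sum.Base as Sum using (_⊎_; inj₁; inj₂)
open import Data.Vec.Base using (_∷_; tabulate; here; there)
open import Data.Vec.Properties using ([]=⇒lookup; lookup⇒[]=; lookup∘tabulate)
open import Effect.Monad using (RawMonad)
open import Function.Base using (_∘_)
open import Function.Bundles using (_⇔_; mk⇔; Equivalence)
open import Induction.WellFounded using (Acc; acc)
open import Level using (0ℓ)
open import Relation.Binary.Construct.Closure.ReflexiveTransitive as Star
  using (Star; ε; _◅_; _◅◅_)
open import Relation.Binary.Core using (Rel)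
open import Relation.Binary.Definitions using (Symmetric)
open import Relation.Binary.PropositionalEquality
open import Relation.Nullary using (¬_; yes; no; contradiction; Dec; does)
open import Relation.Nullary.Decidable
  using (_×-dec_; ¬?; decidable-stable; ¬¬-excluded-middle; dec-true; map′;
         _→-dec_)
open import Relation.Nullary.Negation using (¬¬-Monad)

-- Lists: reversal, insertion and propagation along linked entries.

Unique-↭ : ∀ {A : Set} {xs ys : List A} → xs ↭ ys → Unique xs → Unique ys
Unique-↭ = Unique-resp-↭ (setoid _) ∘ ↭⇒↭ₛ

module _ {A : Set} {R : Rel A 0ℓ} where

  linked-++⁻ʳ : ∀ xs {ys} → Linked R (xs ++ ys) → Linked R ys
  linked-++⁻ʳ []       l = l
  linked-++⁻ʳ (_ ∷ xs) l = linked-++⁻ʳ xs (Linked.tail l)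

  linked-ʳ++ : Symmetric R → ∀ {x} xs {ys} →
               Linked R (x ∷ xs) → Linked R (x ∷ ys) → Linked R (xs ʳ++ x ∷ ys)
  linked-ʳ++ s []       _        m = m
  linked-ʳ++ s (_ ∷ xs) (r ∷ l) m = linked-ʳ++ s xs l (s r ∷ m)

  linked-reverse : Symmetric R → ∀ {xs} → Linked R xs → Linked R (reverse xs)
  linked-reverse s {[]}     _ = []
  linked-reverse s {_ ∷ xs} l = linked-ʳ++ s xs l [-]

  linked-insert : ∀ xs {v u ys} → Linked R (xs ++ v ∷ ys) → R v u →
                  Linked R (u ∷ ys) → Linked R (xs ++ v ∷ u ∷ ys)
  linked-insert []           _       r m = r ∷ m
  linked-insert (_ ∷ [])     (q ∷ l) r m = q ∷ linked-insert [] l r m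
  linked-insert (_ ∷ y ∷ xs) (q ∷ l) r m = q ∷ linked-insert (y ∷ xs) l r m

  -- Symmetry lets `P` spread from one entry in both directions as long as `Q` holds. With `Q` as
  -- avoidance of a separator, it keeps a path inside one component.
  linked-closed : Symmetric R → ∀ {P Q : A → Set} →
                  (∀ {x y} → R x y → P x → Q y → P y) →
                  ∀ {xs} → Linked R xs → All Q xs → Any P xs → All P xs
  linked-closed s closed [-]     _            (here p)  = p ∷ []
  linked-closed s closed (r ∷ l) (_ ∷ q ∷ qs) (here p)  =
    p ∷ linked-closed s closed l (q ∷ qs) (here (closed r p q))
  linked-closed s closed (r ∷ l) (q ∷ qs)     (there a)
    with ps@(p ∷ _) ← linked-closed s closed l qs a = closed (s r) p q ∷ ps

unique-++⁻ʳ : ∀ {A : Set} (xs : List A) {ys} → Unique (xs ++ ys) → Unique ys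
unique-++⁻ʳ []       u       = u
unique-++⁻ʳ (_ ∷ xs) (_ ∷ u) = unique-++⁻ʳ xs u

-- Finite subsets: comprehension and enumeration.

open Equivalence using (to; from)

-- Components of G are formed only below a negated goal, so reachability need
-- not be decided.
¬¬-comprehension : ∀ {n} (P : Fin n → Set) → ¬ ¬ (∃ λ S → ∀ x → x ∈ˢ S ⇔ P x)
¬¬-comprehension P none =
  sequence (RawMonad.rawApplicative ¬¬-Monad) (λ _ → ¬¬-excluded-middle) λ P? →
  none (tabulate (does ∘ P?) , λ x → mk⇔ (sound P? x) (complete P? x))
  where
  sound : ∀ P? x → x ∈ˢ tabulate (does ∘ P?) → P x
  sound P? x x∈ with P? x | trans (sym (lookup∘tabulate (does ∘ P?) x)) ([]=⇒lookup x∈)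
  ... | yes px | _ = px
  complete : ∀ P? x → P x → x ∈ˢ tabulate (does ∘ P?)
  complete P? x px =
    lookup⇒[]= x _ (trans (lookup∘tabulate (does ∘ P?) x) (dec-true (P? x) px))

enum : ∀ {n} (S : Subset n) → Fin ∣ S ∣ → Fin n
enum (outside ∷ S) i       = suc (enum S i)
enum (inside  ∷ S) zero    = zero
enum (inside  ∷ S) (suc i) = suc (enum S i)

enum-∈ : ∀ {n} (S : Subset n) i → enum S i ∈ˢ S
enum-∈ (outside ∷ S) i       = there (enum-∈ S i)
enum-∈ (inside  ∷ S) zero    = here
enum-∈ (inside  ∷ S) (suc i) = there (enum-∈ S i)

enum-injective : ∀ {n} (S : Subset n) {i j} → enum S i ≡ enum S j → i ≡ j
enum-injective (outside ∷ S) e                   = enum-injective S (suc-injective e)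
enum-injective (inside  ∷ S) {zero}  {zero}  _   = refl
enum-injective (inside  ∷ S) {suc i} {suc j} e   = cong suc (enum-injective S (suc-injective e))

module _ {n} (G : Graph (Fin n)) where

  open Graph G

  -- Two longest paths of a connected graph meet.

  reverse-isPath : ∀ {p} → IsPath G p → IsPath G (reverse p)
  reverse-isPath {p} (mkIsPath ne l u) =
    mkIsPath (λ e → ne (empty p (trans (sym (length-reverse p)) (cong length e))))
             (linked-reverse symmetric l)
             (Unique-↭ (↭-sym (↭-reverse p)) u)
    where
    empty : ∀ (p : List (Fin n)) → length p ≡ 0 → p ≡ []
    empty [] _ = refl

  suffix-isPath : ∀ xs {x ys} → IsPath G (xs ++ x ∷ ys) → IsPath G (x ∷ ys)
  suffix-isPath xs (mkIsPath _ l u) =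
    mkIsPath (λ ()) (linked-++⁻ʳ xs l) (unique-++⁻ʳ xs u)

  -- Stands for the longer of the two pieces into which `x` cuts `p`, read from `x`. Both pieces
  -- contain `x`, so the longer has more than half of the vertices; doubling avoids division.
  record Half (p : List (Fin n)) (x : Fin n) : Set where
    constructor mkHalf
    field
      rest   : List (Fin n)
      isPath : IsPath G (x ∷ rest)
      ⊆p     : ∀ {y} → y ∈ x ∷ rest → y ∈ p
      long   : length p < length (x ∷ rest) + length (x ∷ rest)

  half-suffix : ∀ xs {x ys} → IsPath G (xs ++ x ∷ ys) → length xs ≤ length ys →
                Half (xs ++ x ∷ ys) x
  half-suffix xs {x} {ys} π xs≤ys =
    mkHalf ys (suffix-isPath xs π) (∈-++⁺ʳ xs)
      (ℕ.≤-trans (s≤s (ℕ.≤-reflexive (length-++ xs)))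
                 (ℕ.+-monoˡ-≤ (length (x ∷ ys)) (s≤s xs≤ys)))

  reverse-split : ∀ xs {x : Fin n} ys →
                  reverse (xs ++ x ∷ ys) ≡ reverse ys ++ x ∷ reverse xs
  reverse-split xs {x} ys = begin
    reverse (xs ++ x ∷ ys)              ≡⟨ reverse-++ xs (x ∷ ys) ⟩
    reverse (x ∷ ys) ++ reverse xs      ≡⟨ cong (_++ reverse xs) (unfold-reverse x ys) ⟩
    (reverse ys ++ x ∷ []) ++ reverse xs ≡⟨ ++-assoc (reverse ys) _ _ ⟩
    reverse ys ++ x ∷ reverse xs        ∎
    where open ≡-Reasoning

  -- If the piece before `x` is the longer one, `p` is reversed, which turns that piece into a
  -- suffix.
  half : ∀ {p x} → IsPath G p → x ∈ p → Half p x
  half {p} {x} π x∈p with xs , ys , refl ← ∈-∃++ x∈p with ℕ.≤-total (length xs) (length ys)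
  ... | inj₁ xs≤ys = half-suffix xs π xs≤ys
  ... | inj₂ ys≤xs = mkHalf (Half.rest h) (Half.isPath h)
    (∈-resp-↭ (↭-reverse p) ∘ subst (_ ∈_) (sym eq) ∘ Half.⊆p h)
    (subst (_< length (x ∷ Half.rest h) + length (x ∷ Half.rest h))
      (trans (cong length (sym eq)) (length-reverse p)) (Half.long h))
    where
    eq : reverse p ≡ reverse ys ++ x ∷ reverse xs
    eq = reverse-split xs ys
    h : Half (reverse ys ++ x ∷ reverse xs) x
    h = half-suffix (reverse ys) (subst (IsPath G) eq (reverse-isPath π))
          (subst₂ _≤_ (sym (length-reverse ys)) (sym (length-reverse xs)) ys≤xs)

  -- Approach p q r rs says that r ∷ rs is a path that avoids q and ends in a
  -- half of p, if p and q are disjoint.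
  data Approach (p q : List (Fin n)) : Fin n → List (Fin n) → Set where
    start  : ∀ {x} → x ∈ p → (h : Half p x) → Approach p q x (Half.rest h)
    extend : ∀ {s r rs} → Adj s r → s ∉ q → s ∉ r ∷ rs →
             Approach p q r rs → Approach p q s (r ∷ rs)

  module _ {p q : List (Fin n)} (disjoint : ∀ {x} → x ∈ p → x ∉ q) where

    approach-isPath : ∀ {r rs} → Approach p q r rs → IsPath G (r ∷ rs)
    approach-isPath (start _ h)          = Half.isPath h
    approach-isPath (extend e _ s∉ a) with mkIsPath _ l u ← approach-isPath a =
      mkIsPath (λ ()) (e ∷ l) (¬Any⇒All¬ _ s∉ ∷ u)

    approach-avoids : ∀ {r rs} → Approach p q r rs → ∀ {x} → x ∈ r ∷ rs → x ∉ q
    approach-avoids (start _ h)        x∈         = disjoint (Half.⊆p h x∈)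
    approach-avoids (extend _ s∉q _ a) (here refl) = s∉q
    approach-avoids (extend _ _ _ a)   (there x∈) = approach-avoids a x∈

    approach-long : ∀ {r rs} → Approach p q r rs →
                    length p < length (r ∷ rs) + length (r ∷ rs)
    approach-long (start _ h)      = Half.long h
    approach-long (extend {r = r} {rs} _ _ _ a) =
      ℕ.<-≤-trans (approach-long a) (ℕ.+-mono-≤ l≤1+l l≤1+l)
      where
      l≤1+l : length (r ∷ rs) ≤ suc (length (r ∷ rs))
      l≤1+l = ℕ.n≤1+n (length (r ∷ rs))

    -- When `s` lies in the half of `p`, what remains of that half after `s` may be too short, so a
    -- new half of `p` is taken from `s`.
    restart : IsPath G p → ∀ {r rs s} → Approach p q r rs → s ∈ r ∷ rs → ∃ (Approach p q s)
    restart π (start _ h)        s∈          = _ , start (Half.⊆p h s∈) (half π (Half.⊆p h s∈))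
    restart π a@(extend _ _ _ _) (here refl) = _ , a
    restart π (extend _ _ _ a)   (there s∈)  = restart π a s∈

    -- A half of `q`, reversed to end at `s`, is followed by the approach. The two pieces have more
    -- than half as many vertices as `q` and `p`, so the new path is longer than the average of the
    -- two lengths.
    join : IsPath G q → ∀ {r rs s} → Approach p q r rs → Adj r s → s ∈ q →
           ∃ λ w → IsPath G w × length p + length q < length w + length w
    join κ {r} {rs} {s} a e s∈q with mkHalf hs (mkIsPath _ l u) h⊆q hlong ← half κ s∈q
                       with mkIsPath _ l′ u′ ← approach-isPath a =
      w , mkIsPath (λ eq → contradiction (trans (sym (length-ʳ++ (s ∷ hs))) (cong length eq)) λ ())
                   (linked-ʳ++ symmetric hs l (symmetric e ∷ l′))
                   (Unique-↭ (++↭ʳ++ (s ∷ hs) (r ∷ rs))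
                     (++⁺ u u′ λ (x∈h , x∈a) → approach-avoids a x∈a (h⊆q x∈h)))
        , subst (λ m → length p + length q < m + m) (sym (length-ʳ++ (s ∷ hs)))
                (arith (length (s ∷ hs)) (length (r ∷ rs)) (approach-long a) hlong)
      where
      w = (s ∷ hs) ʳ++ (r ∷ rs)
      arith : ∀ {k l} a b → k < b + b → l < a + a → k + l < (a + b) + (a + b)
      arith {k} {l} a b k< l< = begin-strict
        k + l              <⟨ ℕ.+-mono-< k< l< ⟩
        (b + b) + (a + a)  ≡⟨ ℕ.+-comm (b + b) (a + a) ⟩
        (a + a) + (b + b)  ≡⟨ interchange ℕ.+-commutativeSemigroup a a b b ⟩
        (a + b) + (a + b)  ∎
        where open ℕ.≤-Reasoning

    -- The walk is traced until it first enters `q`. Whenever it returns to the current approach,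
    -- the approach is cut back or restarted at that vertex, so loops are erased along the way.
    bridge : IsPath G p → IsPath G q → ∀ {r rs y} → Star Adj r y → y ∈ q → Approach p q r rs →
             ∃ λ w → IsPath G w × length p + length q < length w + length w
    bridge π κ ε y∈q a = contradiction y∈q (approach-avoids a (here refl))
    bridge π κ {r} {rs} (_◅_ {j = s} e es) y∈q a
      with member? Fin._≟_ s q | member? Fin._≟_ s (r ∷ rs)
    ... | yes s∈q | _       = join κ a e s∈q
    ... | no _    | yes s∈a = bridge π κ es y∈q (proj₂ (restart π a s∈a))
    ... | no s∉q  | no s∉a  = bridge π κ es y∈q (extend (symmetric e) s∉q s∉a a)

  -- Otherwise half of p, a path from p to q and half of q make up a path longer
  -- than both.
  longest-meet : Connected G → ∀ {p q} → IsLongestPath G p → IsLongestPath G q →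
                 ¬ (∀ {x} → x ∈ p → x ∉ q)
  longest-meet _ {[]}     (π , _) _ _ = IsPath.nonempty π refl
  longest-meet _ {_ ∷ _} {[]} _ (κ , _) _ = IsPath.nonempty κ refl
  longest-meet (_ , walk) {x ∷ _} {y ∷ _} (π , lp) (κ , lq) disjoint
    with w , ω , short ← bridge disjoint π κ (walk x y) (here refl)
                           (start (here refl) (half π (here refl))) =
    ℕ.<⇒≱ short (ℕ.+-mono-≤ (lp w ω) (lq w ω))

  -- Induced paths, and holes closed by one more vertex.

  Far : Fin n → Fin n → Set
  Far x w = ¬ Adj x w × x ≢ w

  -- InducedPath z x xs says that x ∷ xs is an induced path ending at z.
  data InducedPath (z : Fin n) : Fin n → List (Fin n) → Set where
    [-] : InducedPath z z []
    _∷⟨_⟩_ : ∀ {x y ys} → Adj x y → All (Far x) ys → InducedPath z y ys →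
             InducedPath z x (y ∷ ys)

  adj⇒≢ : ∀ {x y} → Adj x y → x ≢ y
  adj⇒≢ e refl = irreflexive e

  induced-unique : ∀ {z x xs} → InducedPath z x xs → Unique (x ∷ xs)
  induced-unique [-]             = [] ∷ []
  induced-unique (e ∷⟨ far ⟩ ip) = (adj⇒≢ e ∷ All.map proj₂ far) ∷ induced-unique ip

  Consecutive : ∀ {m} → Fin m → Fin m → Set
  Consecutive i j = suc (toℕ i) ≡ toℕ j ⊎ suc (toℕ j) ≡ toℕ i

  consecutive⇒adj : ∀ {z x xs} → InducedPath z x xs → ∀ i j → Consecutive i j →
                    Adj (lookup (x ∷ xs) i) (lookup (x ∷ xs) j)
  consecutive⇒adj (e ∷⟨ _ ⟩ _)  zero    (suc zero)    _        = e
  consecutive⇒adj (e ∷⟨ _ ⟩ _)  (suc zero)    zero    _        = symmetric e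
  consecutive⇒adj (_ ∷⟨ _ ⟩ ip) (suc i) (suc j) c =
    consecutive⇒adj ip i j (Sum.map ℕ.suc-injective ℕ.suc-injective c)
  consecutive⇒adj _ zero zero (inj₁ ())
  consecutive⇒adj _ zero zero (inj₂ ())
  consecutive⇒adj (_ ∷⟨ _ ⟩ _) zero (suc (suc _)) (inj₁ ())
  consecutive⇒adj (_ ∷⟨ _ ⟩ _) zero (suc (suc _)) (inj₂ ())
  consecutive⇒adj (_ ∷⟨ _ ⟩ _) (suc (suc _)) zero (inj₁ ())
  consecutive⇒adj (_ ∷⟨ _ ⟩ _) (suc (suc _)) zero (inj₂ ())

  adj⇒consecutive : ∀ {z x xs} → InducedPath z x xs → ∀ i j →
                    Adj (lookup (x ∷ xs) i) (lookup (x ∷ xs) j) → Consecutive i j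
  adj⇒consecutive _ zero zero e = contradiction e irreflexive
  adj⇒consecutive (_ ∷⟨ _ ⟩ _)   zero          (suc zero)    _ = inj₁ refl
  adj⇒consecutive (_ ∷⟨ _ ⟩ _)   (suc zero)    zero          _ = inj₂ refl
  adj⇒consecutive (_ ∷⟨ far ⟩ _) zero          (suc (suc j)) e =
    contradiction e (proj₁ (All.lookup far (∈-lookup j)))
  adj⇒consecutive (_ ∷⟨ far ⟩ _) (suc (suc i)) zero          e =
    contradiction (symmetric e) (proj₁ (All.lookup far (∈-lookup i)))
  adj⇒consecutive (_ ∷⟨ _ ⟩ ip)  (suc i)       (suc j)       e =
    Sum.map (cong suc) (cong suc) (adj⇒consecutive ip i j e)

  last⇒end : ∀ {z x xs} → InducedPath z x xs → ∀ i → toℕ i ≡ length xs → lookup (x ∷ xs) i ≡ z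
  last⇒end [-]            zero    _ = refl
  last⇒end (_ ∷⟨ _ ⟩ ip)  (suc i) e = last⇒end ip i (ℕ.suc-injective e)

  end∈ : ∀ {z x xs} → InducedPath z x xs → z ∈ x ∷ xs
  end∈ [-]            = here refl
  end∈ (_ ∷⟨ _ ⟩ ip) = there (end∈ ip)

  end⇒last : ∀ {z x xs} → InducedPath z x xs → ∀ i → lookup (x ∷ xs) i ≡ z → toℕ i ≡ length xs
  end⇒last [-]            zero    _ = refl
  end⇒last (_ ∷⟨ _ ⟩ ip)  (suc i) e = cong suc (end⇒last ip i e)
  end⇒last ip@(_ ∷⟨ _ ⟩ ip′) zero e =
    contradiction e (All.lookup (AllPairs.head (induced-unique ip)) (end∈ ip′))

  NonAdjExcept : Fin n → Fin n → Fin n → Set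
  NonAdjExcept z c w = w ≡ z ⊎ Far c w

  -- `c` gets index zero, and its cyclic neighbours are the two ends of the path. The form
  -- `y ∷ w ∷ ws` forces three vertices on the path, hence a cycle of length at least four.
  closing-hole : ∀ {c z x y w ws} → InducedPath z x (y ∷ w ∷ ws) →
                 Adj c x → Adj c z → All (NonAdjExcept z c) (y ∷ w ∷ ws) →
                 InducedCopy (cycle (3 + length (w ∷ ws))) G
  closing-hole {c} {z} {x} {y} {w} {ws} ip cx cz non = record
    { embed     = lookup (c ∷ xs)
    ; injective = unique⇒lookup-injective (c≢ ∷ induced-unique ip)
    ; adj⇔      = λ i j → mk⇔ (cycle⇒adj i j) (adj⇒cycle i j)
    }
    where
    xs = x ∷ y ∷ w ∷ ws
    c≢ : All (c ≢_) xs
    c≢ = adj⇒≢ cx ∷ All.map Sum.[ (λ { refl → adj⇒≢ cz }) , proj₂ ] non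
    C = Graph.Adj (cycle (suc (length xs)))

    chord : ∀ j → Next zero (suc j) ⊎ Next (suc j) zero → Adj c (lookup xs j)
    chord zero    _ = cx
    chord (suc j) (inj₁ (inj₁ ()))
    chord (suc j) (inj₁ (inj₂ ()))
    chord (suc j) (inj₂ (inj₁ ()))
    -- The wrap-around pair is the edge between the last path vertex `z` and `c`.
    chord (suc j) (inj₂ (inj₂ (e , _))) =
      subst (Adj c) (sym (last⇒end ip (suc j) (ℕ.suc-injective (ℕ.suc-injective e)))) cz

    chord⁻¹ : ∀ j → Adj c (lookup xs j) → Next zero (suc j) ⊎ Next (suc j) zero
    chord⁻¹ zero    _ = inj₁ (inj₁ refl)
    chord⁻¹ (suc j) e with All.lookup non (∈-lookup j)
    ... | inj₁ eq  = inj₂ (inj₂ (cong (2 +_) (end⇒last ip (suc j) eq) , refl))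
    ... | inj₂ far = contradiction e (proj₁ far)

    -- Wrapping around would end at index zero, which belongs to `c`.
    next⇒consecutive : ∀ {i j : Fin (length xs)} → Next (suc i) (suc j) → suc (toℕ i) ≡ toℕ j
    next⇒consecutive (inj₁ e) = ℕ.suc-injective e
    next⇒consecutive (inj₂ ())

    cycle⇒adj : ∀ i j → C i j → Adj (lookup (c ∷ xs) i) (lookup (c ∷ xs) j)
    cycle⇒adj zero    zero    (ne , _) = contradiction refl ne
    cycle⇒adj zero    (suc j) (_ , e)  = chord j e
    cycle⇒adj (suc i) zero    (_ , e)  = symmetric (chord i (Sum.swap e))
    cycle⇒adj (suc i) (suc j) (_ , e)  =
      consecutive⇒adj ip i j (Sum.map next⇒consecutive next⇒consecutive e)

    adj⇒cycle : ∀ i j → Adj (lookup (c ∷ xs) i) (lookup (c ∷ xs) j) → C i j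
    adj⇒cycle i j e = (λ { refl → irreflexive e }) , next i j e
      where
      next : ∀ i j → Adj (lookup (c ∷ xs) i) (lookup (c ∷ xs) j) → Next i j ⊎ Next j i
      next zero    zero    e = contradiction e irreflexive
      next zero    (suc j) e = chord⁻¹ j e
      next (suc i) zero    e = Sum.swap (chord⁻¹ i (symmetric e))
      next (suc i) (suc j) e =
        Sum.map (inj₁ ∘ cong suc) (inj₁ ∘ cong suc) (adj⇒consecutive ip i j e)

  -- Induced paths extracted from walks.

  module _ {P : Fin n → Set} {z : Fin n} where

    -- The tail is tried first, so `a` attaches to its last neighbour on the path and is far from
    -- everything after that neighbour. If `a` itself lies on the path, the path is cut at `a`.
    shortcut : ∀ {a x xs} → P a → InducedPath z x xs → All P (x ∷ xs) →
               (∃ λ ys → InducedPath z a ys × All P (a ∷ ys)) ⊎ All (Far a) (x ∷ xs)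
    shortcut {a} {x} pa ip ps with a Fin.≟ x | a adj? x | ip | ps
    ... | yes refl | _     | _    | _      = inj₁ (_ , ip , ps)
    ... | no  _    | yes e | [-]  | _ = inj₁ (_ , e ∷⟨ [] ⟩ ip , pa ∷ ps)
    ... | no  a≢x  | no ¬e | [-]  | _ = inj₂ ((¬e , a≢x) ∷ [])
    ... | no  a≢x  | d     | _ ∷⟨ _ ⟩ ip′ | _ ∷ ps′ with shortcut pa ip′ ps′ | d
    ...   | inj₁ r   | _     = inj₁ r
    ...   | inj₂ far | yes e = inj₁ (_ , e ∷⟨ far ⟩ ip , pa ∷ ps)
    ...   | inj₂ far | no ¬e = inj₂ ((¬e , a≢x) ∷ far)

    walk⇒induced : ∀ {a} → P z → Star (λ x y → Adj x y × P x) a z →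
                   ∃ λ xs → InducedPath z a xs × All P (a ∷ xs)
    walk⇒induced pz ε = [] , [-] , pz ∷ []
    walk⇒induced pz ((e , pa) ◅ es)
      with xs , ip , ps ← walk⇒induced pz es with shortcut pa ip ps
    ... | inj₁ r              = r
    ... | inj₂ ((¬e , _) ∷ _) = contradiction e ¬e

  -- Connected vertex sets whose boundary is a clique.

  module _ (C : Subset n) where

    InnerStep : Fin n → Fin n → Set
    InnerStep x y = Adj x y × x ∈ˢ C × y ∈ˢ C

    Boundary : Fin n → Set
    Boundary z = z ∉ˢ C × ∃ λ c → c ∈ˢ C × Adj c z

    CliqueBoundary : Set
    CliqueBoundary = ∀ {x y} → Boundary x → Boundary y → x ≢ y → Adj x y

    InnerConnected : Set
    InnerConnected = ∀ {x y} → x ∈ˢ C → y ∈ˢ C → Star InnerStep x y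

  module _ (chordal : Chordal G) (C : Subset n) where

    -- Walking back from z: if c misses the penultimate vertex u, then the first
    -- neighbour of c met after z closes a hole through c and z.
    penultimate : ∀ {z x y ys} → InducedPath z x (y ∷ ys) →
      All (λ w → w ≡ z ⊎ w ∈ˢ C) (x ∷ y ∷ ys) →
      ∃ λ u → u ∈ˢ C × Adj u z ×
        (∀ c → c ∉ˢ C → Adj c z → Adj c u ⊎ All (NonAdjExcept z c) (x ∷ y ∷ ys))
    penultimate {z} {x} (e ∷⟨ [] ⟩ [-]) (inj₁ refl ∷ _) = contradiction e irreflexive
    penultimate {z} {x} (e ∷⟨ [] ⟩ [-]) (inj₂ x∈C ∷ _) = x , x∈C , e , sees
      where
      sees : ∀ c → c ∉ˢ C → Adj c z → Adj c x ⊎ All (NonAdjExcept z c) (x ∷ z ∷ [])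
      sees c c∉C _ with c adj? x
      ... | yes cx = inj₁ cx
      ... | no ¬cx = inj₂ (inj₂ (¬cx , λ { refl → c∉C x∈C }) ∷ inj₁ refl ∷ [])
    penultimate {z} {x} {y} {w ∷ ws} ip@(e ∷⟨ _ ⟩ ip′@(_ ∷⟨ _ ⟩ _)) (px ∷ ps)
      with u , u∈C , uz , sees ← penultimate ip′ ps = u , u∈C , uz , sees′ px
      where
      sees′ : x ≡ z ⊎ x ∈ˢ C → ∀ c → c ∉ˢ C → Adj c z →
              Adj c u ⊎ All (NonAdjExcept z c) (x ∷ y ∷ w ∷ ws)
      sees′ px c c∉C cz with sees c c∉C cz
      ... | inj₁ cu  = inj₁ cu
      ... | inj₂ non with px | c adj? x
      ...   | inj₁ x≡z | _      = inj₂ (inj₁ x≡z ∷ non)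
      ...   | inj₂ x∈C | no ¬cx = inj₂ (inj₂ (¬cx , λ { refl → c∉C x∈C }) ∷ non)
      ...   | inj₂ _   | yes cx =
        contradiction (closing-hole ip cx cz non) (chordal _ (s≤s (s≤s (s≤s (s≤s z≤n)))))

    -- u is the penultimate vertex of an induced path from v through C to z.
    improve : CliqueBoundary C → InnerConnected C →
              ∀ {v z} → v ∈ˢ C → Boundary C z →
              ∃ λ u → u ∈ˢ C × Adj u z × (∀ c → Boundary C c → Adj v c → Adj u c)
    improve clique conn {v} {z} v∈C ∂z@(z∉C , b , b∈C , bz)
      with walk⇒induced {P = λ w → w ≡ z ⊎ w ∈ˢ C} (inj₁ refl) walk
      where
      step : ∀ {x y} → InnerStep C x y → Adj x y × (x ≡ z ⊎ x ∈ˢ C)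
      step (e , x∈C , _) = e , inj₂ x∈C
      walk : Star (λ x y → Adj x y × (x ≡ z ⊎ x ∈ˢ C)) v z
      walk = Star.map step (conn v∈C b∈C) ◅◅ ((bz , inj₂ b∈C) ◅ ε)
    ... | [] , [-] , _ = contradiction v∈C z∉C
    ... | _ ∷ _ , ip , ps with u , u∈C , uz , sees ← penultimate ip ps = u , u∈C , uz , keeps
      where
      keeps : ∀ c → Boundary C c → Adj v c → Adj u c
      keeps c ∂c@(c∉C , _) vc with c Fin.≟ z
      ... | yes refl = uz
      -- The clique boundary makes `c` adjacent to `z`. The path starts at `v`, a neighbour of `c`
      -- other than `z`, so `c` cannot miss all of the path but `z`; hence it sees `u`.
      ... | no c≢z with sees c c∉C (clique ∂c ∂z c≢z)
      ...   | inj₁ cu                = symmetric cu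
      ...   | inj₂ (inj₁ refl ∷ _)   = contradiction v∈C z∉C
      ...   | inj₂ (inj₂ (¬cv , _) ∷ _) = contradiction (symmetric vc) ¬cv

  -- Existence of a clique transversal.

  Clique : Subset n → Set
  Clique K = ∀ {x y} → x ∈ˢ K → y ∈ˢ K → x ≢ y → Adj x y

  isLongestPath? : ∀ p → Dec (IsLongestPath G p)
  isLongestPath? p = isPath? G p ×-dec allPaths? G (λ q → length q ℕ.≤? length p)

  -- A path has at most `n` vertices, so a finite search finds the avoiding longest path.
  ¬transversal⇒avoiding : ∀ {S} → ¬ IsTransversal G S →
                          ∃ λ p → IsLongestPath G p × ¬ Any (_∈ˢ S) p
  ¬transversal⇒avoiding {S} ¬tr
    with Any.any? (λ p → isLongestPath? p ×-dec ¬? (Any.any? (_∈? S) p)) (listsUpTo n n)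
  ... | yes a    = let p , _ , lp = find a in p , lp
  ... | no  none = contradiction tr ¬tr
    where
    tr : IsTransversal G S
    tr p lp = decidable-stable (Any.any? (_∈? S) p) λ avoids →
      none (lose (∈-listsUpTo p (unique⇒length≤ (IsPath.unique (proj₁ lp)))) (lp , avoids))

  module _ (chordal : Chordal G) {C : Subset n}
           (clique : CliqueBoundary C) (connected : InnerConnected C) where

    -- Starting from any vertex of `C`, the boundary vertices are treated one at a time: each
    -- replacement of `v` by `improve` gains `z` and keeps the boundary neighbours gained before.
    dominating : ∀ {x} → x ∈ˢ C → ∃ λ v → v ∈ˢ C × (∀ z → Boundary C z → Adj v z)
    dominating {x} x∈C =
      let v , v∈C , sees = go (allFin n) in v , v∈C , λ z → All.lookup sees (∈-allFin z)
      where
      ∂ = Boundary C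
      ∂? : ∀ z → Dec (∂ z)
      ∂? z = ¬? (z ∈? C) ×-dec any? (λ c → (c ∈? C) ×-dec (c adj? z))
      go : ∀ zs → ∃ λ v → v ∈ˢ C × All (λ z → ∂ z → Adj v z) zs
      go []       = x , x∈C , []
      go (z ∷ zs) with v , v∈C , sees ← go zs | ∂? z
      ... | no ¬∂z = v , v∈C , (λ ∂z → contradiction ∂z ¬∂z) ∷ sees
      ... | yes ∂z with u , u∈C , uz , keeps ← improve chordal C clique connected v∈C ∂z =
        u , u∈C , (λ _ → uz) ∷ All.map (λ {c} vc ∂c → keeps c ∂c (vc ∂c)) sees

  module _ (chordal : Chordal G) (conn : Connected G)
           (none : ∀ K → Clique K → ¬ IsTransversal G K) where

    -- Induction on the size of `C`: a longest path inside `C` would yield a smaller set of the same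
    -- kind that again contains a longest path.
    descent : ∀ C → Acc _<_ ∣ C ∣ → CliqueBoundary C → InnerConnected C →
      ∀ p → IsLongestPath G p → ¬ All (_∈ˢ C) p
    descent C _ _ _ [] (π , _) _ = IsPath.nonempty π refl
    descent C (acc rs) clique inner p@(_ ∷ _) lp ps@(p∈C ∷ _)
      with v , v∈C , dom ← dominating chordal clique inner p∈C =
      ¬¬-comprehension (λ x → x ≡ v ⊎ ∂ x) λ (K , K⇔) →
      let q , lq , avoids = ¬transversal⇒avoiding (none K λ {x} {y} x∈K y∈K →
                              K-clique (to (K⇔ x) x∈K) (to (K⇔ y) y∈K))
      in
      -- The goal is absurd, so a common vertex `x` of `p` and `q` may be assumed.
      longest-meet conn lp lq λ {x} x∈p x∈q →
      let x∈C = All.lookup ps x∈p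
          outsideK : ∀ {y} → y ∈ q → ¬ (y ≡ v ⊎ ∂ y)
          outsideK {y} y∈q y∈K = avoids (lose y∈q (from (K⇔ y) y∈K))
          x≢v = outsideK x∈q ∘ inj₁
      in
      -- `C′` is the component of `C` without `v` that contains `x`.
      ¬¬-comprehension (Star Step x) λ (C′ , C′⇔) →
      let ∈C−v : ∀ {y} → y ∈ˢ C′ → y ∈ˢ C × y ≢ v
          ∈C−v {y} y∈C′ = reach (x∈C , x≢v) (to (C′⇔ y) y∈C′)
          grow : ∀ {a b} → a ∈ˢ C′ → Adj a b → b ∈ˢ C → b ≢ v → b ∈ˢ C′
          grow {a} {b} a∈C′ e b∈C b≢v = from (C′⇔ b) (to (C′⇔ a) a∈C′ ◅◅ ((e , b∈C , b≢v) ◅ ε))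
          -- As `C′` is a full component, its boundary lies in the clique formed by `v` and the
          -- boundary of `C`.
          edge-out : ∀ {a b} → a ∈ˢ C′ → Adj a b → b ∉ˢ C′ → b ≡ v ⊎ ∂ b
          edge-out {a} {b} a∈C′ e b∉C′ = leave (proj₁ (∈C−v a∈C′)) e λ (b∈C , b≢v) →
            b∉C′ (grow a∈C′ e b∈C b≢v)
          root : ∀ {y} → Star Step x y → Star (InnerStep C′) x y
          root = within (λ {a} s → from (C′⇔ a) s) ε
      in
      descent C′
        (rs (p⊂q⇒∣p∣<∣q∣ (proj₁ ∘ ∈C−v , v , v∈C , λ v∈C′ → proj₂ (∈C−v v∈C′) refl)))
        (λ { (a∉ , _ , c∈ , ca) (b∉ , _ , d∈ , db) →
             K-clique (edge-out c∈ ca a∉) (edge-out d∈ db b∉) })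
        (λ {a} {b} a∈ b∈ →
             Star.reverse (λ (e , c∈ , d∈) → symmetric e , d∈ , c∈) (root (to (C′⇔ a) a∈))
             ◅◅ root (to (C′⇔ b) b∈))
        q lq
        -- `q` meets `C′` in `x` and avoids that clique, so it never leaves `C′`.
        (linked-closed symmetric
          (λ {_} {b} e a∈ b∉K → decidable-stable (b ∈? C′) (b∉K ∘ edge-out a∈ e))
          (IsPath.linked (proj₁ lq)) (All.tabulate outsideK) (lose x∈q (from (C′⇔ x) ε)))
      where
      ∂ = Boundary C

      Step : Fin n → Fin n → Set
      Step a b = Adj a b × b ∈ˢ C × b ≢ v

      K-clique : ∀ {x y} → x ≡ v ⊎ ∂ x → y ≡ v ⊎ ∂ y → x ≢ y → Adj x y
      K-clique (inj₁ refl) (inj₁ refl) x≢y = contradiction refl x≢y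
      K-clique (inj₁ refl) (inj₂ ∂y)   _   = dom _ ∂y
      K-clique (inj₂ ∂x)   (inj₁ refl) _   = symmetric (dom _ ∂x)
      K-clique (inj₂ ∂x)   (inj₂ ∂y)   x≢y = clique ∂x ∂y x≢y

      reach : ∀ {x y} → x ∈ˢ C × x ≢ v → Star Step x y → y ∈ˢ C × y ≢ v
      reach h ε                   = h
      reach _ ((_ , h) ◅ es) = reach h es

      leave : ∀ {a b} → a ∈ˢ C → Adj a b → ¬ (b ∈ˢ C × b ≢ v) → b ≡ v ⊎ ∂ b
      leave {a} {b} a∈C e out with b Fin.≟ v | b ∈? C
      ... | yes b≡v | _       = inj₁ b≡v
      ... | no  b≢v | yes b∈C = contradiction (b∈C , b≢v) out
      ... | no  _   | no  b∉C = inj₂ (b∉C , a , a∈C , e)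

      -- The walk accumulated from `x` certifies that every vertex passed lies in `C′`.
      within : ∀ {C′ x y z} → (∀ {a} → Star Step x a → a ∈ˢ C′) → Star Step x y → Star Step y z →
               Star (InnerStep C′) y z
      within close s ε        = ε
      within close s (e ◅ es) =
        (proj₁ e , close s , close (s ◅◅ (e ◅ ε))) ◅ within close (s ◅◅ (e ◅ ε)) es

  -- Subsets are finite in number and both properties are decidable, so refuting nonexistence
  -- suffices. The descent starts from all vertices, whose boundary is empty.
  clique-transversal : Chordal G → Connected G → ∃ λ K → Clique K × IsTransversal G K
  clique-transversal chordal conn =
    decidable-stable (anySubset? λ K → clique? K ×-dec isTransversal? G K) λ none →
    let none′ = λ K (cl : Clique K) tr → none (K , cl , tr)
        -- The empty clique is no transversal either, which supplies an initial longest path.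
        p , lp , _ = ¬transversal⇒avoiding (none′ ∅ λ x∈∅ → contradiction x∈∅ ∉⊥)
    in
    descent chordal conn none′ fullSet (<-wellFounded _)
      (λ (x∉ , _) → contradiction ∈⊤ x∉)
      (λ {x} {y} _ _ → Star.map (λ e → e , ∈⊤ , ∈⊤) (proj₂ conn x y))
      p lp (All.universal (λ _ → ∈⊤) p)
    where
    clique? : ∀ K → Dec (Clique K)
    clique? K = map′ (λ f {x} {y} → f x y) (λ f x y → f)
      (all? λ x → all? λ y → (x ∈? K) →-dec ((y ∈? K) →-dec (¬? (x Fin.≟ y) →-dec (x adj? y))))

  -- Minimal clique transversals and private neighbours.

  minimal-clique-transversal : ∀ K → Acc _<_ ∣ K ∣ → Clique K → IsTransversal G K →
    ∃ λ M → Clique M × IsTransversal G M × (∀ v → v ∈ˢ M → ¬ IsTransversal G (M - v))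
  minimal-clique-transversal K (acc rs) cl tr
    with any? (λ v → (v ∈? K) ×-dec isTransversal? G (K - v))
  ... | no  minimal         = K , cl , tr , λ v v∈K tr′ → minimal (v , v∈K , tr′)
  ... | yes (v , v∈K , tr′) = minimal-clique-transversal (K - v) (rs (x∈p⇒∣p-x∣<∣p∣ v∈K))
    (λ x∈ y∈ → cl (p─q⊆p K ⁅ v ⁆ x∈) (p─q⊆p K ⁅ v ⁆ y∈)) tr′

  -- Putting `u` right after `v` would give a path with one more vertex. The case of empty `ys` says
  -- that a longest path cannot be prolonged at its end.
  insert-longer : ∀ xs {v u ys} → IsLongestPath G (xs ++ v ∷ ys) → u ∉ xs ++ v ∷ ys →
                  Adj v u → ¬ Linked Adj (u ∷ ys)
  insert-longer xs {v} {u} {ys} (mkIsPath _ l un , longest) u∉ e l′ =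
    ℕ.<-irrefl refl (subst (_≤ length (xs ++ v ∷ ys)) (↭-length shifted) (longest longer
      (mkIsPath (λ eq → contradiction (subst (v ∈_) eq (∈-insert xs)) λ ())
                (linked-insert xs l e l′)
                (Unique-↭ (↭-sym shifted) (¬Any⇒All¬ _ u∉ ∷ un)))))
    where
    longer = xs ++ v ∷ u ∷ ys
    shifted : longer ↭ u ∷ xs ++ v ∷ ys
    shifted = subst₂ _↭_ (++-assoc xs (v ∷ []) (u ∷ ys)) (cong (u ∷_) (++-assoc xs (v ∷ []) ys))
                (shift u (xs ++ v ∷ []) ys)

  PrivateNeighbour : Subset n → Fin n → Fin n → Set
  PrivateNeighbour K v x = Adj v x × x ∉ˢ K × (∀ {u} → u ∈ˢ K → Adj u x → u ≡ v)

  -- Without `v` some longest path is missed, so it meets `K` in `v` alone. If `v` were its last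
  -- vertex, a second vertex of `K` could be appended; this is where `2 ≤ ∣ K ∣` enters. Otherwise
  -- the successor of `v` is the private neighbour.
  private-neighbour : ∀ {K} → Clique K → 2 ≤ ∣ K ∣ → IsTransversal G K →
    ∀ {v} → v ∈ˢ K → ¬ IsTransversal G (K - v) → ∃ (PrivateNeighbour K v)
  private-neighbour {K} cl 2≤K tr {v} v∈K ¬tr
    with p , lp , avoids ← ¬transversal⇒avoiding ¬tr = find-next (∈-∃++ v∈p)
    where
    only-v : ∀ {u} → u ∈ˢ K → u ∈ p → u ≡ v
    only-v {u} u∈K u∈p = decidable-stable (u Fin.≟ v) λ u≢v →
      avoids (lose u∈p (x∈p∧x≢y⇒x∈p-y u∈K u≢v))

    v∈p : v ∈ p
    v∈p with u , u∈p , u∈K ← find (tr p lp) = subst (_∈ p) (only-v u∈K u∈p) u∈p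

    other : ∃ λ u → u ∈ˢ K × u ≢ v
    other = decidable-stable (any? λ u → (u ∈? K) ×-dec ¬? (u Fin.≟ v)) λ none →
      ℕ.<⇒≱ 2≤K (ℕ.≤-trans
        (p⊆q⇒∣p∣≤∣q∣ λ {u} u∈K → subst (_∈ˢ ⁅ v ⁆)
          (sym (decidable-stable (u Fin.≟ v) λ u≢v → none (u , u∈K , u≢v))) (x∈⁅x⁆ v))
        (ℕ.≤-reflexive (∣⁅x⁆∣≡1 v)))

    blocked : ∀ {xs ys} → p ≡ xs ++ v ∷ ys → ∀ {u} → u ∈ˢ K → u ≢ v → ¬ Linked Adj (u ∷ ys)
    blocked {xs} refl u∈K u≢v =
      insert-longer xs lp (λ u∈p → u≢v (only-v u∈K u∈p)) (cl v∈K u∈K (≢-sym u≢v))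

    find-next : (∃ λ xs → ∃ λ ys → p ≡ xs ++ v ∷ ys) → ∃ (PrivateNeighbour K v)
    find-next (xs , [] , eq) with u , u∈K , u≢v ← other = contradiction [-] (blocked eq u∈K u≢v)
    find-next (xs , x ∷ ys , refl)
      with e ∷ l′ ← linked-++⁻ʳ xs (IsPath.linked (proj₁ lp)) =
      x , e
        , (λ x∈K → irreflexive (subst (Adj v) (only-v x∈K (∈-++⁺ʳ xs (there (here refl)))) e))
        , λ {u} u∈K ux → decidable-stable (u Fin.≟ v) λ u≢v → blocked refl u∈K u≢v (ux ∷ l′)

  -- Any `t` vertices of `K` serve as the clique side. Privacy makes the edges to the chosen
  -- neighbours a matching, and chordality makes those neighbours independent.
  matched-copy : Chordal G → ∀ {t K} → t ≤ ∣ K ∣ → Clique K →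
                 (∀ {v} → v ∈ˢ K → ∃ (PrivateNeighbour K v)) → InducedCopy (K⋈K̄ t) G
  matched-copy chordal {t} {K} t≤K cl neighbour = record
    { embed     = embed
    ; injective = λ {a} {b} → embed-injective a b
    ; adj⇔      = λ a b → mk⇔ (forth a b) (back a b)
    }
    where
    k : Fin t → Fin n
    k i = enum K (inject≤ i t≤K)

    k∈K : ∀ i → k i ∈ˢ K
    k∈K i = enum-∈ K (inject≤ i t≤K)

    k-injective : ∀ {i j} → k i ≡ k j → i ≡ j
    k-injective e = inject≤-injective t≤K t≤K _ _ (enum-injective K e)

    x : Fin t → Fin n
    x i = proj₁ (neighbour (k∈K i))

    kx : ∀ i → Adj (k i) (x i)
    kx i = proj₁ (proj₂ (neighbour (k∈K i)))

    x∉K : ∀ i → x i ∉ˢ K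
    x∉K i = proj₁ (proj₂ (proj₂ (neighbour (k∈K i))))

    kx⇒≡ : ∀ {i j} → Adj (k i) (x j) → i ≡ j
    kx⇒≡ {i} {j} e = k-injective (proj₂ (proj₂ (proj₂ (neighbour (k∈K j)))) (k∈K i) e)

    k≢x : ∀ {i j} → k i ≢ x j
    k≢x {i} {j} e = x∉K j (subst (_∈ˢ K) e (k∈K i))

    -- An edge between x i and x j completes the hole k i, x i, x j, k j.
    x-independent : ∀ {i j} → ¬ Adj (x i) (x j)
    x-independent {i} {j} e = chordal 4 ℕ.≤-refl (closing-hole
      (e ∷⟨ (i≢j ∘ sym ∘ kx⇒≡ ∘ symmetric , ≢-sym k≢x) ∷ [] ⟩ (symmetric (kx j) ∷⟨ [] ⟩ [-]))
      (kx i) (cl (k∈K i) (k∈K j) (i≢j ∘ k-injective))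
      (inj₂ (i≢j ∘ kx⇒≡ , k≢x) ∷ inj₁ refl ∷ []))
      where
      i≢j : i ≢ j
      i≢j refl = irreflexive e

    embed : Fin t ⊎ Fin t → Fin n
    embed = Sum.[ k , x ]

    embed-injective : ∀ a b → embed a ≡ embed b → a ≡ b
    embed-injective (inj₁ i) (inj₁ j) e = cong inj₁ (k-injective e)
    embed-injective (inj₁ i) (inj₂ j) e = contradiction e k≢x
    embed-injective (inj₂ i) (inj₁ j) e = contradiction (sym e) k≢x
    -- If `x i` equals `x j`, then `k i` is adjacent to `x j`, and privacy gives `i ≡ j`.
    embed-injective (inj₂ i) (inj₂ j) e = cong inj₂ (kx⇒≡ (subst (Adj (k i)) e (kx i)))

    forth : ∀ a b → MatchedAdj a b → Adj (embed a) (embed b)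
    forth (inj₁ i) (inj₁ j) i≢j  = cl (k∈K i) (k∈K j) (i≢j ∘ k-injective)
    forth (inj₁ i) (inj₂ _) refl = kx i
    forth (inj₂ i) (inj₁ _) refl = symmetric (kx i)

    back : ∀ a b → Adj (embed a) (embed b) → MatchedAdj a b
    back (inj₁ i) (inj₁ j) e = λ { refl → irreflexive e }
    back (inj₁ i) (inj₂ j) e = kx⇒≡ e
    back (inj₂ i) (inj₁ j) e = sym (kx⇒≡ (symmetric e))
    back (inj₂ i) (inj₂ j) e = x-independent e

theorem3p11 : ∀ (t : ℕ) → 2 ≤ t → ∀ {n : ℕ} (G : Graph (Fin n)) → Connected G → Chordal G → ¬ InducedCopy (K⋈K̄ t) G → lpt G ≤ t ∸ 1
theorem3p11 t 2≤t G conn chordal free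
  with K , cl , tr ← clique-transversal G chordal conn
  with M , clM , trM , minimal ← minimal-clique-transversal G K (<-wellFounded _) cl tr =
  ℕ.≤-trans (proj₂ (lpt-isLpt G) M trM) (ℕ.∸-monoˡ-≤ 1 M<t)
  where
  M<t : ∣ M ∣ < t
  -- If `t ≤ ∣ M ∣`, then `M` has at least two vertices, so private neighbours exist and produce the
  -- excluded copy.
  M<t = ℕ.≰⇒> λ t≤M → free (matched-copy G chordal t≤M clM λ v∈M →
    private-neighbour G clM (ℕ.≤-trans 2≤t t≤M) trM v∈M (minimal _ v∈M))
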